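{- Let $\xi=(L^\xi,\Delta_0^\xi,B^\xi,d,G)$ be a generic configuration. If $\xi$ is 0-stable, then $B^\xi+\mathrm{SelfCons}^0(B^\xi,d)$ (with deduction method $d$) is self-justifying. (This result applies also when $\xi$ is E-stable or A-stable.)
   Context: **Generic configurations.** Standard-M is the standard model of the natural numbers. $\mathrm{Log}$ is the base-2 logarithm. A generic configuration $\xi$ is a 5-tuple $(L^\xi,\Delta_0^\xi,B^\xi,d,G)$ where: (1) $L^\xi$ is a language with symbols for $0,1,2,=,\le$ and $\mathrm{Maximum}(x,y)$, and enough function and constant symbols that every integer $k$ is the value of some term $T_k$. (2) $\Delta_0^\xi$ is a fixed class of fully bounded $L^\xi$-formulas (all quantifiers have the form $\exists v\le T$ or $\forall v\le T$ with $T$ a term), closed under negation, and rich enough to contain two formulas $\mathrm{Add}(x,y,z)$ and $\mathrm{Mult}(x,y,z)$ defining the graphs of addition and multiplication. Every $\Delta_0^\xi$ formula is both $\Pi_0^\xi$ and $\Sigma_0^\xi$; for $n\ge1$ a formula is $\Pi_n^\xi$ (resp. $\Sigma_n^\xi$) iff it can be written $\forall v_1\cdots\forall v_k\,\Phi$ with $\Phi\in\Sigma_{n-1}^\xi$ (resp. $\exists v_1\cdots\exists v_k\,\Phi$ with $\Phi\in\Pi_{n-1}^\xi$); $\Delta_0^\xi$ sentences count as both $\Pi_1^\xi$ and $\Sigma_1^\xi$. (3) $B^\xi$ (the base axiom system) is an axiom system whose axioms are true in Standard-M and which is $\Sigma_1^\xi$-complete: it proves every true $\Sigma_1^\xi$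 sentence and refutes every false $\Pi_1^\xi$ sentence. (4) $d$ is a deduction method, conventional enough to satisfy the indirect-implication property associated with Gödel's Completeness Theorem: whether or not modus ponens is built in, whenever it can prove $X$, $Y$ and $(X\wedge Y)\to Z$, it can prove $Z$ (possibly by a much longer proof). (5) $G$ is a method for encoding the Gödel numbers of proofs. Proofs are identified with their Gödel numbers $p$. **Goodness.** $E(N)$ is a term of value $2^N$. For a prenex sentence $\Upsilon$, $\mathrm{Scope}_E(\Upsilon,N)$ is obtained from $\Upsilon$ by replacing each unbounded $\forall v$ by $\forall v<E(N)$ and each unbounded $\exists v$ by $\exists v<E(N)$, leaving the bounded quantifiers of the $\Delta_0^\xi$ part unchanged. A $\Pi_1^\xi$ or $\Sigma_1^\xi$ sentence $\Upsilon$ is $\mathrm{Good}(N)$ when $\mathrm{Scope}_E(\Upsilon,N)$ is true in Standard-M ($\mathrm{Good}(\infty)$ means true in Standard-M). For a set $\theta$ of $\Pi_1^\xi$ sentences, $\sharp(\theta)$ is the largest integer $J$ such that every sentence of $\theta$ is $\mathrm{Good}(J)$, and $\sharp(\theta)=\infty$ if this holds for all $J$. **Stability.** $\mathrm{RE\text{ - }Class}(\xi)$ is the set of all recursively enumerable sets $\theta$ of $\Pi_1^\xi$ sentences (true or not). - $\xi$ is A-stable iff for every $\theta\in\mathrm{RE\text{ - }Class}(\xi)$: if $\Upsilon$ is a $\Pi_1^\xi$ theorem of $\theta\cup B^\xi$ via a proof $p$ with $\mathrm{Log}(p)\le\sharp(\theta)+1$, then $\Upsilon$ is $\mathrm{Good}\{\tfrac12\sharp(\theta)\}$.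 - $\xi$ is E-stable iff for every $\theta\in\mathrm{RE\text{ - }Class}(\xi)$: if $\Upsilon$ is a $\Sigma_1^\xi$ theorem of $\theta\cup B^\xi$ via a proof $p$ with $\mathrm{Log}(p)\le\sharp(\theta)+1$, then $\Upsilon$ is $\mathrm{Good}\{\tfrac12\lfloor\mathrm{Log}(p)\rfloor-1\}$. - $\xi$ is 0-stable iff for every $\theta\in\mathrm{RE\text{ - }Class}(\xi)$: if $\Upsilon$ is a $\Delta_0^\xi$ theorem of $\theta\cup B^\xi$ via a proof $p$ with $\mathrm{Log}(p)\le\sharp(\theta)+1$, then $\Upsilon$ is true in Standard-M. **Self-consistency axioms.** An axiom system $\alpha\supseteq B^\xi$ is Level$(k^\xi)$ consistent when there are no proofs from $\alpha$ via $d$ of both a $\Pi_k^\xi$ sentence and the $\Sigma_k^\xi$ sentence that is its negation. For $\beta\supseteq B^\xi$, $\mathrm{SelfCons}^k(\beta,d)$ is a self-referencing $\Pi_1^\xi$ sentence asserting the Level$(k^\xi)$ consistency of $\beta+\mathrm{SelfCons}^k(\beta,d)$. Explicitly, use $\Delta_0^\xi$ formulas: $\mathrm{Neg}^k(x,y)$: $x$ is the Gödel number of a $\Pi_k^\xi$ sentence and $y$ that of the $\Sigma_k^\xi$ sentence which is its negation; $\mathrm{SubstPrf}^d_\beta(g,t,p)$: there is $h$ such that $h$ encodes the sentence obtained from the formula with code $g$ by replacing its free variables by the numeral $\bar g$, and $p$ is a proof of $t$ via $d$ from $\beta$ together with the sentence coded by $h$. Let $\Gamma^k(g)$ be $\forall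 x\forall y\forall p\forall q\ \neg\{\mathrm{Neg}^k(x,y)\wedge\mathrm{SubstPrf}^d_\beta(g,x,p)\wedge\mathrm{SubstPrf}^d_\beta(g,y,q)\}$ and $n$ its Gödel number; then $\mathrm{SelfCons}^k(\beta,d)$ is $\Gamma^k(\bar n)$. **Self-justification.** A pair $(\alpha,d)$ (axiom system, deduction method) is self-justifying when (i) one of $\alpha$'s theorems states that $d$, applied to $\alpha$, produces a consistent set of theorems, and (ii) $\alpha$ is in fact consistent. -}

module Defs where

open import Data.Bool using (Bool; true; T; not; _∧_; _∨_)
open import Data.Empty using (⊥)
open import Data.Fin using (Fin; zero; suc)
open import Data.Nat using (ℕ; zero; suc; _+_; _*_; _∸_; _^_; _≤_; _<_; _⊔_)
open import Data.Nat.Logarithm using (⌊log₂_⌋)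
open import Data.Product using (Σ-syntax; ∃-syntax; _×_; _,_)
open import Data.Unit using (⊤)
open import Data.Vec using (Vec; []; _∷_; lookup; replicate)
open import Data.Vec.Relation.Binary.Pointwise.Inductive using (Pointwise)
open import Function.Bundles using (_⇔_)
open import Level using (0ℓ)
open import Relation.Binary.PropositionalEquality using (_≡_)
open import Relation.Nullary using (¬_)
open import Relation.Unary using (Pred; _∪_; _≐_; ｛_｝)

------------------------------------------------------------------------
-- Partial recursive functions and recursively enumerable sets

data Rec : ℕ → Set where
  zer  : ∀ {n} → Rec n
  succ : Rec 1
  proj : ∀ {n} → Fin n → Rec n
  comp : ∀ {m n} → Rec m → Vec (Rec n) m → Rec n
  prec : ∀ {n} → Rec n → Rec (suc (suc n)) → Rec (suc n)
  mu   : ∀ {n} → Rec (suc n) → Rec n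

infix 4 _[_]⇓_

data _[_]⇓_ : ∀ {n} → Rec n → Vec ℕ n → ℕ → Set where
  zer⇓   : ∀ {n} {xs : Vec ℕ n} → zer [ xs ]⇓ 0
  succ⇓  : ∀ {x} → succ [ x ∷ [] ]⇓ suc x
  proj⇓  : ∀ {n} {xs : Vec ℕ n} i → proj i [ xs ]⇓ lookup xs i
  comp⇓  : ∀ {m n} {f : Rec m} {gs : Vec (Rec n) m} {xs ys z} →
           Pointwise (λ g y → g [ xs ]⇓ y) gs ys → f [ ys ]⇓ z →
           comp f gs [ xs ]⇓ z
  prec⇓₀ : ∀ {n} {f : Rec n} {g xs z} →
           f [ xs ]⇓ z → prec f g [ 0 ∷ xs ]⇓ z
  prec⇓₊ : ∀ {n} {f : Rec n} {g xs k y z} →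
           prec f g [ k ∷ xs ]⇓ y → g [ k ∷ y ∷ xs ]⇓ z →
           prec f g [ suc k ∷ xs ]⇓ z
  mu⇓    : ∀ {n} {f : Rec (suc n)} {xs k} →
           f [ k ∷ xs ]⇓ 0 →
           (∀ j → j < k → ∃[ y ] f [ j ∷ xs ]⇓ suc y) →
           mu f [ xs ]⇓ k

RecursivelyEnumerable : Pred ℕ 0ℓ → Set
RecursivelyEnumerable S =
  ∃[ f ] (∀ x → S x ⇔ (∃[ m ] f [ m ∷ [] ]⇓ x))

------------------------------------------------------------------------
-- Languages, formulas and the standard model

-- Equality and ≤ are primitive formula constructors.  A language carries
-- its interpretation in the standard model.
record Language : Set₁ where
  field
    Fun : ℕ → Set
    Rel : ℕ → Set
    funᴹ : ∀ {k} → Fun k → Vec ℕ k → ℕ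
    relᴹ : ∀ {k} → Rel k → Vec ℕ k → Bool
    zeroˢ oneˢ twoˢ : Fun 0
    maxˢ : Fun 2
    zeroᴹ : funᴹ zeroˢ [] ≡ 0
    oneᴹ  : funᴹ oneˢ [] ≡ 1
    twoᴹ  : funᴹ twoˢ [] ≡ 2
    maxᴹ  : ∀ x y → funᴹ maxˢ (x ∷ y ∷ []) ≡ x ⊔ y

data Term (L : Language) (n : ℕ) : Set where
  var : Fin n → Term L n
  fun : ∀ {k} → Language.Fun L k → Vec (Term L n) k → Term L n

infix  8 _≈'_ _≤'_
infix  7 ¬'_
infixr 6 _∧'_
infixr 5 _∨'_
infixr 4 _⇒'_

-- Well-scoped de Bruijn syntax: a formula with free variables among n.
-- In ∀≤ t Φ and ∃≤ t Φ the bound t lies outside the scope of the quantifier.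
data Formula (L : Language) (n : ℕ) : Set where
  _≈'_ _≤'_ : Term L n → Term L n → Formula L n
  rel       : ∀ {k} → Language.Rel L k → Vec (Term L n) k → Formula L n
  ¬'_       : Formula L n → Formula L n
  _∧'_ _∨'_ _⇒'_ : Formula L n → Formula L n → Formula L n
  ∀≤ ∃≤     : Term L n → Formula L (suc n) → Formula L n
  ∀' ∃'     : Formula L (suc n) → Formula L n

Sentence : Language → Set
Sentence L = Formula L 0

module _ {L : Language} where
  open Language L

  mutual
    evalᵗ : ∀ {n} → Vec ℕ n → Term L n → ℕ
    evalᵗ ρ (var i)    = lookup ρ i
    evalᵗ ρ (fun f ts) = funᴹ f (evalᵗˢ ρ ts)

    evalᵗˢ : ∀ {n k} → Vec ℕ n → Vec (Term L n) k → Vec ℕ k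
    evalᵗˢ ρ []       = []
    evalᵗˢ ρ (t ∷ ts) = evalᵗ ρ t ∷ evalᵗˢ ρ ts

  -- Classical truth in the standard model: disjunction and existence are
  -- read under ¬ ¬, so that ⟦ Φ ⟧ ρ is always ¬¬-stable.
  ⟦_⟧ : ∀ {n} → Formula L n → Vec ℕ n → Set
  ⟦ s ≈' t ⟧   ρ = evalᵗ ρ s ≡ evalᵗ ρ t
  ⟦ s ≤' t ⟧   ρ = evalᵗ ρ s ≤ evalᵗ ρ t
  ⟦ rel R ts ⟧ ρ = T (relᴹ R (evalᵗˢ ρ ts))
  ⟦ ¬' Φ ⟧     ρ = ¬ ⟦ Φ ⟧ ρ
  ⟦ Φ ∧' Ψ ⟧   ρ = ⟦ Φ ⟧ ρ × ⟦ Ψ ⟧ ρ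
  ⟦ Φ ∨' Ψ ⟧   ρ = ¬ (¬ ⟦ Φ ⟧ ρ × ¬ ⟦ Ψ ⟧ ρ)
  ⟦ Φ ⇒' Ψ ⟧   ρ = ⟦ Φ ⟧ ρ → ⟦ Ψ ⟧ ρ
  ⟦ ∀≤ t Φ ⟧   ρ = ∀ v → v ≤ evalᵗ ρ t → ⟦ Φ ⟧ (v ∷ ρ)
  ⟦ ∃≤ t Φ ⟧   ρ = ¬ ¬ (∃[ v ] v ≤ evalᵗ ρ t × ⟦ Φ ⟧ (v ∷ ρ))
  ⟦ ∀' Φ ⟧     ρ = ∀ v → ⟦ Φ ⟧ (v ∷ ρ)
  ⟦ ∃' Φ ⟧     ρ = ¬ ¬ (∃[ v ] ⟦ Φ ⟧ (v ∷ ρ))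

  True : Sentence L → Set
  True Φ = ⟦ Φ ⟧ []

  mutual
    subᵗ : ∀ {n m} → (Fin n → Term L m) → Term L n → Term L m
    subᵗ σ (var i)    = σ i
    subᵗ σ (fun f ts) = fun f (subᵗˢ σ ts)

    subᵗˢ : ∀ {n m k} → (Fin n → Term L m) → Vec (Term L n) k → Vec (Term L m) k
    subᵗˢ σ []       = []
    subᵗˢ σ (t ∷ ts) = subᵗ σ t ∷ subᵗˢ σ ts

  lift : ∀ {n m} → (Fin n → Term L m) → Fin (suc n) → Term L (suc m)
  lift σ zero    = var zero
  lift σ (suc i) = subᵗ (λ j → var (suc j)) (σ i)

  sub : ∀ {n m} → (Fin n → Term L m) → Formula L n → Formula L m
  sub σ (s ≈' t)   = subᵗ σ s ≈' subᵗ σ t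
  sub σ (s ≤' t)   = subᵗ σ s ≤' subᵗ σ t
  sub σ (rel R ts) = rel R (subᵗˢ σ ts)
  sub σ (¬' Φ)     = ¬' sub σ Φ
  sub σ (Φ ∧' Ψ)   = sub σ Φ ∧' sub σ Ψ
  sub σ (Φ ∨' Ψ)   = sub σ Φ ∨' sub σ Ψ
  sub σ (Φ ⇒' Ψ)   = sub σ Φ ⇒' sub σ Ψ
  sub σ (∀≤ t Φ)   = ∀≤ (subᵗ σ t) (sub (lift σ) Φ)
  sub σ (∃≤ t Φ)   = ∃≤ (subᵗ σ t) (sub (lift σ) Φ)
  sub σ (∀' Φ)     = ∀' (sub (lift σ) Φ)
  sub σ (∃' Φ)     = ∃' (sub (lift σ) Φ)

  infix 9 _⟨_⟩
  _⟨_⟩ : ∀ {n m} → Formula L n → Vec (Term L m) n → Formula L m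
  Φ ⟨ ts ⟩ = sub (lookup ts) Φ

  FullyBounded : ∀ {n} → Formula L n → Set
  FullyBounded (s ≈' t)   = ⊤
  FullyBounded (s ≤' t)   = ⊤
  FullyBounded (rel R ts) = ⊤
  FullyBounded (¬' Φ)     = FullyBounded Φ
  FullyBounded (Φ ∧' Ψ)   = FullyBounded Φ × FullyBounded Ψ
  FullyBounded (Φ ∨' Ψ)   = FullyBounded Φ × FullyBounded Ψ
  FullyBounded (Φ ⇒' Ψ)   = FullyBounded Φ × FullyBounded Ψ
  FullyBounded (∀≤ t Φ)   = FullyBounded Φ
  FullyBounded (∃≤ t Φ)   = FullyBounded Φ
  FullyBounded (∀' Φ)     = ⊥
  FullyBounded (∃' Φ)     = ⊥

  -- The negation of a prenex formula, again in prenex form: it takes Πₖ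
  -- formulas to Σₖ formulas, and is plain ¬' on fully bounded formulas.
  prenexNeg : ∀ {n} → Formula L n → Formula L n
  prenexNeg (∀' Φ) = ∃' (prenexNeg Φ)
  prenexNeg (∃' Φ) = ∀' (prenexNeg Φ)
  prenexNeg Φ      = ¬' Φ

  -- Boolean value when atomic and quantified formulas are taken as
  -- propositional variables with valuation v.
  boolValue : ∀ {n} → (Formula L n → Bool) → Formula L n → Bool
  boolValue v (¬' Φ)   = not (boolValue v Φ)
  boolValue v (Φ ∧' Ψ) = boolValue v Φ ∧ boolValue v Ψ
  boolValue v (Φ ∨' Ψ) = boolValue v Φ ∨ boolValue v Ψ
  boolValue v (Φ ⇒' Ψ) = not (boolValue v Φ) ∨ boolValue v Ψ
  boolValue v Φ        = v Φ

  Tautology : Sentence L → Set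
  Tautology Φ = ∀ v → boolValue v Φ ≡ true

  -- Relativises the quantifier prefix to values below the closed term E:
  -- v < E is rendered as v ≤ E together with v ≠ E.
  scope : ∀ {n} → Term L 0 → Formula L n → Formula L n
  scope E (∀' Φ) = ∀≤ (subᵗ (λ ()) E) (¬' (var zero ≈' subᵗ (λ ()) E) ⇒' scope E Φ)
  scope E (∃' Φ) = ∃≤ (subᵗ (λ ()) E) (¬' (var zero ≈' subᵗ (λ ()) E) ∧' scope E Φ)
  scope E Φ      = Φ

-- The hierarchy over a given class Δ₀.  Quantifier blocks may be empty.
module Hierarchy {L : Language} (Δ₀ : ∀ {n} → Formula L n → Set) where
  mutual
    data Πᶠ : ℕ → ∀ {n} → Formula L n → Set where
      base : ∀ {n} {Φ : Formula L n} → Δ₀ Φ → Πᶠ 0 Φ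
      fromΣ : ∀ {k n} {Φ : Formula L n} → Σᶠ k Φ → Πᶠ (suc k) Φ
      all  : ∀ {k n} {Φ : Formula L (suc n)} → Πᶠ (suc k) Φ → Πᶠ (suc k) (∀' Φ)

    data Σᶠ : ℕ → ∀ {n} → Formula L n → Set where
      base : ∀ {n} {Φ : Formula L n} → Δ₀ Φ → Σᶠ 0 Φ
      fromΠ : ∀ {k n} {Φ : Formula L n} → Πᶠ k Φ → Σᶠ (suc k) Φ
      ex   : ∀ {k n} {Φ : Formula L (suc n)} → Σᶠ (suc k) Φ → Σᶠ (suc k) (∃' Φ)

------------------------------------------------------------------------
-- Generic configurations

record DeductionMethod (L : Language) : Set₁ where
  field
    Proof : Set
    Proves : Proof → Pred (Sentence L) 0ℓ → Sentence L → Set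
    -- axiom systems are sets: only their extension matters
    proves-ext : ∀ {π α β Φ} → α ≐ β → Proves π α Φ → Proves π β Φ

  infix 3 _⊢_
  _⊢_ : Pred (Sentence L) 0ℓ → Sentence L → Set
  α ⊢ Φ = ∃[ π ] Proves π α Φ

  -- indirectImplication is the closure property of a conventional method.
  -- It yields explosion only if (X ∧ ¬ X) ⇒ Z is available, so proving axioms
  -- and propositional tautologies is required too.  Soundness and built-in
  -- modus ponens are not.
  field
    axiom : ∀ {α Φ} → α Φ → α ⊢ Φ
    tautology : ∀ {α Φ} → Tautology Φ → α ⊢ Φ
    indirectImplication : ∀ {α X Y Z} → α ⊢ X → α ⊢ Y → α ⊢ X ∧' Y ⇒' Z → α ⊢ Z

record Gödelisation (L : Language) (d : DeductionMethod L) : Set where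
  open DeductionMethod d
  field
    -- a formula is coded together with the number of its free variables
    ⌜_⌝ : ∀ {n} → Formula L n → ℕ
    ⌜⌝-injective : ∀ {n m} {Φ : Formula L n} {Ψ : Formula L m} →
      ⌜ Φ ⌝ ≡ ⌜ Ψ ⌝ → _≡_ {A = Σ[ k ∈ ℕ ] Formula L k} (n , Φ) (m , Ψ)
    ⌜_⌝ᵖ : Proof → ℕ
    ⌜⌝ᵖ-injective : ∀ {π π'} → ⌜ π ⌝ᵖ ≡ ⌜ π' ⌝ᵖ → π ≡ π'

record Configuration : Set₁ where
  field
    L : Language
    numeral : ℕ → Term L 0
    numeral-value : ∀ k → evalᵗ [] (numeral k) ≡ k

    Δ₀ : ∀ {n} → Formula L n → Set
    Δ₀-bounded : ∀ {n} {Φ : Formula L n} → Δ₀ Φ → FullyBounded Φ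
    Δ₀-¬ : ∀ {n} {Φ : Formula L n} → Δ₀ Φ → Δ₀ (¬' Φ)
    -- from Φ(x₁,…,xₙ) to the sentence Φ(t₁,…,tₙ), the tᵢ closed
    Δ₀-instance : ∀ {n} {Φ : Formula L n} (ts : Vec (Term L 0) n) → Δ₀ Φ → Δ₀ (Φ ⟨ ts ⟩)
    Add Mult : Formula L 3
    Add-Δ₀  : Δ₀ Add
    Mult-Δ₀ : Δ₀ Mult
    Add-graph  : ∀ x y z → ⟦ Add ⟧ (x ∷ y ∷ z ∷ []) ⇔ x + y ≡ z
    Mult-graph : ∀ x y z → ⟦ Mult ⟧ (x ∷ y ∷ z ∷ []) ⇔ x * y ≡ z

  open Hierarchy {L} Δ₀ public

  field
    B : Pred (Sentence L) 0ℓ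
    d : DeductionMethod L
    G : Gödelisation L d

  open DeductionMethod d public
  open Gödelisation G public

  field
    B-true : ∀ {Φ} → B Φ → True Φ
    B-proves-true-Σ₁ : ∀ {Φ} → Σᶠ 1 Φ → True Φ → B ⊢ Φ
    B-refutes-false-Π₁ : ∀ {Φ} → Πᶠ 1 Φ → ¬ True Φ → B ⊢ ¬' Φ

------------------------------------------------------------------------
-- Goodness and stability

data ℕ∞ : Set where
  fin : ℕ → ℕ∞
  ∞   : ℕ∞

module _ (ξ : Configuration) where
  open Configuration ξ

  Good : ℕ → Sentence L → Set
  Good N Υ = True (scope (numeral (2 ^ N)) Υ)

  -- Good½ a is Good(a/2).  The bound b has the same naturals below it as
  -- 2^(a/2), because v < 2^(a/2) iff v² < 2^a; for even a it is 2^(a/2).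
  Good½ : ℕ → Sentence L → Set
  Good½ a Υ = ∃[ b ] (∀ v → v < b ⇔ v * v < 2 ^ a) × True (scope (numeral b) Υ)

  Good½∞ : ℕ∞ → Sentence L → Set
  Good½∞ (fin J) Υ = Good½ J Υ
  Good½∞ ∞       Υ = True Υ

  AllGood : Pred (Sentence L) 0ℓ → ℕ → Set
  AllGood θ J = ∀ {Φ} → θ Φ → Good J Φ

  -- J is ♯(θ).  If θ is not even Good(0) there is no such J: for N ≤ 0 the
  -- condition v < 2^N always means v = 0, so negative integers fail too.
  Sharp : Pred (Sentence L) 0ℓ → ℕ∞ → Set
  Sharp θ (fin J) = AllGood θ J × (∀ J' → AllGood θ J' → J' ≤ J)
  Sharp θ ∞       = ∀ J → AllGood θ J

  -- Log p ≤ J + 1, exponentiated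
  Log≤1+ : ℕ → ℕ∞ → Set
  Log≤1+ p (fin J) = p ≤ 2 ^ suc J
  Log≤1+ p ∞       = ⊤

  REClass : Pred (Sentence L) 0ℓ → Set
  REClass θ = (∀ {Φ} → θ Φ → Πᶠ 1 Φ)
            × RecursivelyEnumerable (λ x → ∃[ Φ ] θ Φ × ⌜ Φ ⌝ ≡ x)

  AStable : Set₁
  AStable = ∀ θ J → REClass θ → Sharp θ J → ∀ Υ π → Πᶠ 1 Υ →
    Proves π (θ ∪ B) Υ → Log≤1+ ⌜ π ⌝ᵖ J → Good½∞ J Υ

  -- ½⌊Log p⌋ - 1 = (⌊Log p⌋ - 2)/2.  Truncated subtraction is harmless: at a
  -- negative exponent, as at 0, the only admissible value of v is 0.
  EStable : Set₁
  EStable = ∀ θ J → REClass θ → Sharp θ J → ∀ Υ π → Σᶠ 1 Υ →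
    Proves π (θ ∪ B) Υ → Log≤1+ ⌜ π ⌝ᵖ J → Good½ (⌊log₂ ⌜ π ⌝ᵖ ⌋ ∸ 2) Υ

  ZeroStable : Set₁
  ZeroStable = ∀ θ J → REClass θ → Sharp θ J → ∀ Υ π → Δ₀ Υ →
    Proves π (θ ∪ B) Υ → Log≤1+ ⌜ π ⌝ᵖ J → True Υ

------------------------------------------------------------------------
-- Self-consistency and self-justification

  IsProofOf : Pred (Sentence L) 0ℓ → ℕ → ℕ → Set
  IsProofOf α t p = ∃[ Φ ] ∃[ π ] ⌜ Φ ⌝ ≡ t × ⌜ π ⌝ᵖ ≡ p × Proves π α Φ

  IsNegPair : ℕ → ℕ → ℕ → Set
  IsNegPair k x y = Σ[ Φ ∈ Sentence L ] Πᶠ k Φ × ⌜ Φ ⌝ ≡ x × ⌜ prenexNeg Φ ⌝ ≡ y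

  IsSubstPrf : Pred (Sentence L) 0ℓ → ℕ → ℕ → ℕ → Set
  IsSubstPrf β g t p = ∃[ n ] Σ[ Φ ∈ Formula L n ] ⌜ Φ ⌝ ≡ g ×
    IsProofOf (β ∪ ｛ Φ ⟨ replicate n (numeral g) ⟩ ｝) t p

  -- Γᵏ(g), reading ∀x ∀y ∀p ∀q with g free
  diagonal : Formula L 2 → Formula L 3 → Formula L 1
  diagonal Neg SubstPrf = ∀' (∀' (∀' (∀' (¬' (Neg ⟨ x ∷ y ∷ [] ⟩
                                           ∧' SubstPrf ⟨ g ∷ x ∷ p ∷ [] ⟩
                                           ∧' SubstPrf ⟨ g ∷ y ∷ q ∷ [] ⟩)))))
    where
      q p y x g : Term L 5
      q = var zero
      p = var (suc zero)
      y = var (suc (suc zero))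
      x = var (suc (suc (suc zero)))
      g = var (suc (suc (suc (suc zero))))

  diagonalise : Formula L 1 → Sentence L
  diagonalise Γ = Γ ⟨ numeral ⌜ Γ ⌝ ∷ [] ⟩

  record SelfConsFormula (k : ℕ) (β : Pred (Sentence L) 0ℓ) : Set where
    field
      Neg : Formula L 2
      Neg-Δ₀ : Δ₀ Neg
      Neg-def : ∀ x y → ⟦ Neg ⟧ (x ∷ y ∷ []) ⇔ IsNegPair k x y
      SubstPrf : Formula L 3
      SubstPrf-Δ₀ : Δ₀ SubstPrf
      SubstPrf-def : ∀ g t p → ⟦ SubstPrf ⟧ (g ∷ t ∷ p ∷ []) ⇔ IsSubstPrf β g t p
      -- Δ₀ is not assumed closed under ∧' or under renaming of variables
      isΠ₁ : Πᶠ 1 (diagonalise (diagonal Neg SubstPrf))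

    SelfCons : Sentence L
    SelfCons = diagonalise (diagonal Neg SubstPrf)

  -- Υ reads: for all x, y, p, q, it is not the case that y is the negation
  -- of the Πₖ sentence x, p proves x from α, and q proves y from α.
  -- The environment lists the variables innermost first.
  record StatesConsistency (k : ℕ) (α : Pred (Sentence L) 0ℓ) (Υ : Sentence L) : Set where
    field
      negation proof₁ proof₂ : Formula L 4
      shape : Υ ≡ ∀' (∀' (∀' (∀' (¬' (negation ∧' proof₁ ∧' proof₂)))))
      negation-def : ∀ x y p q → ⟦ negation ⟧ (q ∷ p ∷ y ∷ x ∷ []) ⇔ IsNegPair k x y
      proof₁-def : ∀ x y p q → ⟦ proof₁ ⟧ (q ∷ p ∷ y ∷ x ∷ []) ⇔ IsProofOf α x p
      proof₂-def : ∀ x y p q → ⟦ proof₂ ⟧ (q ∷ p ∷ y ∷ x ∷ []) ⇔ IsProofOf α y q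

  Consistent : Pred (Sentence L) 0ℓ → Set
  Consistent α = ∀ Ψ → ¬ ((α ⊢ Ψ) × (α ⊢ ¬' Ψ))

  -- k is the level at which the theorem Υ asserts consistency.
  record SelfJustifying (k : ℕ) (α : Pred (Sentence L) 0ℓ) : Set where
    field
      Υ : Sentence L
      provable : α ⊢ Υ
      states : StatesConsistency k α Υ
      consistent : Consistent α

{-# OPTIONS --safe #-}
-- Suppose α = B + SelfCons is inconsistent.  By explosion α proves some Δ₀
-- sentence together with its negation, so the Π₁ sentence SelfCons is false
-- and θ = { SelfCons } has a finite sharp J.  Then some x, y, p, q < 2^(J+1)
-- witness the failure of SelfCons: p and q are proofs from θ ∪ B of a Δ₀
-- sentence and of its negation, with logarithms at most J + 1.  By
-- 0-stability both sentences are true, which is absurd.  E- and A-stability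
-- specialise to 0-stability, since scoping does not change bounded sentences.
module Submission where

open import Defs
open import Data.Bool using (T; true; false)
open import Data.Fin using (Fin; zero; suc)
open import Data.Nat using (ℕ; zero; suc; _+_; _^_; _≤_; _<_; z≤n; s≤s)
open import Data.Nat.Properties
  using (≤-trans; <⇒≤; ≤∧≢⇒<; <⇒≢; <-≤-trans; ≰⇒>; _≤?_; n<1⇒n≡0;
         m≤m+n; m≤n+m; ^-monoʳ-≤; +-mono-≤; m^n>0; +-identityʳ)
open import Data.Product using (Σ-syntax; ∃-syntax; _×_; _,_)
open import Data.Product.Function.NonDependent.Propositional using (_×-⇔_)
open import Data.Sum using (_⊎_; inj₂; [_,_]; swap)
open import Data.Vec using (Vec; []; _∷_; lookup)
open import Data.Vec.Relation.Binary.Pointwise.Inductive using ([]; _∷_)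
open import Function using (_∘_)
open import Function.Bundles using (_⇔_; mk⇔; Equivalence)
open import Function.Construct.Composition using (_⇔-∘_)
open import Level using (0ℓ)
open import Relation.Binary.PropositionalEquality
  using (_≡_; refl; sym; trans; cong; cong₂; subst)
open import Relation.Nullary using (¬_; yes; no)
open import Relation.Unary using (Pred; _∪_; ｛_｝)

open Equivalence using (to; from)

-- Truth in the standard model under substitution and scoping.

≡⇒⇔ : {A B : Set} → A ≡ B → A ⇔ B
≡⇒⇔ refl = mk⇔ (λ a → a) (λ a → a)

¬-cong : {A B : Set} → A ⇔ B → (¬ A) ⇔ (¬ B)
¬-cong A⇔B = mk⇔ (_∘ from A⇔B) (_∘ to A⇔B)

module _ {L : Language} where
  open Language L

  mutual
    evalᵗ-sub : ∀ {n m} {σ : Fin n → Term L m} {ρ ρ'} →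
      (∀ i → evalᵗ ρ (σ i) ≡ lookup ρ' i) → ∀ t → evalᵗ ρ (subᵗ σ t) ≡ evalᵗ ρ' t
    evalᵗ-sub σ≗ (var i)    = σ≗ i
    evalᵗ-sub σ≗ (fun f ts) = cong (funᴹ f) (evalᵗˢ-sub σ≗ ts)

    evalᵗˢ-sub : ∀ {n m k} {σ : Fin n → Term L m} {ρ ρ'} →
      (∀ i → evalᵗ ρ (σ i) ≡ lookup ρ' i) →
      (ts : Vec (Term L n) k) → evalᵗˢ ρ (subᵗˢ σ ts) ≡ evalᵗˢ ρ' ts
    evalᵗˢ-sub σ≗ []       = refl
    evalᵗˢ-sub σ≗ (t ∷ ts) = cong₂ _∷_ (evalᵗ-sub σ≗ t) (evalᵗˢ-sub σ≗ ts)

  evalᵗ-lift : ∀ {n m} {σ : Fin n → Term L m} {ρ ρ'} →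
    (∀ i → evalᵗ ρ (σ i) ≡ lookup ρ' i) →
    ∀ v i → evalᵗ (v ∷ ρ) (lift σ i) ≡ lookup (v ∷ ρ') i
  evalᵗ-lift         σ≗ v zero    = refl
  evalᵗ-lift {σ = σ} σ≗ v (suc i) = trans (evalᵗ-sub (λ _ → refl) (σ i)) (σ≗ i)

  mutual
    -- The hypothesis is pointwise, so it passes under binders by `evalᵗ-lift`. An equality of the
    -- two types, in place of an equivalence, would need function extensionality at the quantifiers.
    ⟦⟧-sub : ∀ {n m} {σ : Fin n → Term L m} {ρ ρ'} →
      (∀ i → evalᵗ ρ (σ i) ≡ lookup ρ' i) → ∀ Φ → ⟦ sub σ Φ ⟧ ρ ⇔ ⟦ Φ ⟧ ρ'
    ⟦⟧-sub σ≗ (s ≈' t)   = ≡⇒⇔ (cong₂ _≡_ (evalᵗ-sub σ≗ s) (evalᵗ-sub σ≗ t))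
    ⟦⟧-sub σ≗ (s ≤' t)   = ≡⇒⇔ (cong₂ _≤_ (evalᵗ-sub σ≗ s) (evalᵗ-sub σ≗ t))
    ⟦⟧-sub σ≗ (rel R ts) = ≡⇒⇔ (cong (T ∘ relᴹ R) (evalᵗˢ-sub σ≗ ts))
    ⟦⟧-sub σ≗ (¬' Φ)     = ¬-cong (⟦⟧-sub σ≗ Φ)
    ⟦⟧-sub σ≗ (Φ ∧' Ψ)   = ⟦⟧-sub σ≗ Φ ×-⇔ ⟦⟧-sub σ≗ Ψ
    ⟦⟧-sub σ≗ (Φ ∨' Ψ)   =
      ¬-cong (¬-cong (⟦⟧-sub σ≗ Φ) ×-⇔ ¬-cong (⟦⟧-sub σ≗ Ψ))
    ⟦⟧-sub σ≗ (Φ ⇒' Ψ)   = mk⇔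
      (λ h → to (⟦⟧-sub σ≗ Ψ) ∘ h ∘ from (⟦⟧-sub σ≗ Φ))
      (λ h → from (⟦⟧-sub σ≗ Ψ) ∘ h ∘ to (⟦⟧-sub σ≗ Φ))
    ⟦⟧-sub σ≗ (∀≤ t Φ)   = mk⇔
      (λ h v v≤t → to (⟦⟧-lift σ≗ Φ v) (h v (subst (v ≤_) (sym (evalᵗ-sub σ≗ t)) v≤t)))
      (λ h v v≤t → from (⟦⟧-lift σ≗ Φ v) (h v (subst (v ≤_) (evalᵗ-sub σ≗ t) v≤t)))
    ⟦⟧-sub σ≗ (∃≤ t Φ)   = mk⇔
      (λ h k → h λ (v , v≤t , φ) →
        k (v , subst (v ≤_) (evalᵗ-sub σ≗ t) v≤t , to (⟦⟧-lift σ≗ Φ v) φ))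
      (λ h k → h λ (v , v≤t , φ) →
        k (v , subst (v ≤_) (sym (evalᵗ-sub σ≗ t)) v≤t , from (⟦⟧-lift σ≗ Φ v) φ))
    ⟦⟧-sub σ≗ (∀' Φ)     = mk⇔
      (λ h v → to (⟦⟧-lift σ≗ Φ v) (h v)) (λ h v → from (⟦⟧-lift σ≗ Φ v) (h v))
    ⟦⟧-sub σ≗ (∃' Φ)     = mk⇔
      (λ h k → h λ (v , φ) → k (v , to (⟦⟧-lift σ≗ Φ v) φ))
      (λ h k → h λ (v , φ) → k (v , from (⟦⟧-lift σ≗ Φ v) φ))

    ⟦⟧-lift : ∀ {n m} {σ : Fin n → Term L m} {ρ ρ'} →
      (∀ i → evalᵗ ρ (σ i) ≡ lookup ρ' i) →
      ∀ Φ v → ⟦ sub (lift σ) Φ ⟧ (v ∷ ρ) ⇔ ⟦ Φ ⟧ (v ∷ ρ')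
    ⟦⟧-lift σ≗ Φ v = ⟦⟧-sub (evalᵗ-lift σ≗ v) Φ

  evalᵗ-lookup : ∀ {n k} (ρ : Vec ℕ n) (ts : Vec (Term L n) k) i →
    evalᵗ ρ (lookup ts i) ≡ lookup (evalᵗˢ ρ ts) i
  evalᵗ-lookup ρ (t ∷ ts) zero    = refl
  evalᵗ-lookup ρ (t ∷ ts) (suc i) = evalᵗ-lookup ρ ts i

  ⟦⟧-instance : ∀ {n k} (Φ : Formula L k) (ts : Vec (Term L n) k) {ρ} →
    ⟦ Φ ⟨ ts ⟩ ⟧ ρ ⇔ ⟦ Φ ⟧ (evalᵗˢ ρ ts)
  ⟦⟧-instance Φ ts {ρ} = ⟦⟧-sub (evalᵗ-lookup ρ ts) Φ

  scope-bounded : ∀ {n} E (Φ : Formula L n) → FullyBounded Φ → scope E Φ ≡ Φ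
  scope-bounded E (s ≈' t)   _ = refl
  scope-bounded E (s ≤' t)   _ = refl
  scope-bounded E (rel R ts) _ = refl
  scope-bounded E (¬' Φ)     _ = refl
  scope-bounded E (Φ ∧' Ψ)   _ = refl
  scope-bounded E (Φ ∨' Ψ)   _ = refl
  scope-bounded E (Φ ⇒' Ψ)   _ = refl
  scope-bounded E (∀≤ t Φ)   _ = refl
  scope-bounded E (∃≤ t Φ)   _ = refl

  prenexNeg-bounded : ∀ {n} (Φ : Formula L n) → FullyBounded Φ → prenexNeg Φ ≡ ¬' Φ
  prenexNeg-bounded (s ≈' t)   _ = refl
  prenexNeg-bounded (s ≤' t)   _ = refl
  prenexNeg-bounded (rel R ts) _ = refl
  prenexNeg-bounded (¬' Φ)     _ = refl
  prenexNeg-bounded (Φ ∧' Ψ)   _ = refl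
  prenexNeg-bounded (Φ ∨' Ψ)   _ = refl
  prenexNeg-bounded (Φ ⇒' Ψ)   _ = refl
  prenexNeg-bounded (∀≤ t Φ)   _ = refl
  prenexNeg-bounded (∃≤ t Φ)   _ = refl

  -- Undoes the rendering of `v < E` as `v ≤ E` with `v ≠ E`. Since `E` is closed, its value is the
  -- same in every environment.
  scope-∀' : ∀ {n} (E : Term L 0) (Φ : Formula L (suc n)) {ρ} →
    ⟦ scope E (∀' Φ) ⟧ ρ ⇔ (∀ v → v < evalᵗ [] E → ⟦ scope E Φ ⟧ (v ∷ ρ))
  scope-∀' E Φ = mk⇔
    (λ h v v<E → h v (subst (v ≤_) (sym closed) (<⇒≤ v<E)) (λ v≡E → <⇒≢ v<E (trans v≡E closed)))
    (λ h v v≤E v≢E → h v (≤∧≢⇒< (subst (v ≤_) closed v≤E) (λ v≡E → v≢E (trans v≡E (sym closed)))))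
    where
      closed : ∀ {m} {ρ : Vec ℕ m} → evalᵗ ρ (subᵗ (λ ()) E) ≡ evalᵗ [] E
      closed = evalᵗ-sub (λ ()) E

  ex-falso-tautology : (Φ Ψ : Sentence L) → Tautology (Φ ∧' ¬' Φ ⇒' Ψ)
  ex-falso-tautology Φ Ψ v with boolValue v Φ
  ... | true  = refl
  ... | false = refl

-- Constant recursive functions, which enumerate singletons, and powers of two.

constant : ∀ {n} → ℕ → Rec n
constant zero    = zer
constant (suc c) = comp succ (constant c ∷ [])

constant⇓ : ∀ {n} {xs : Vec ℕ n} c → constant c [ xs ]⇓ c
constant⇓ zero    = zer⇓
constant⇓ (suc c) = comp⇓ (constant⇓ c ∷ []) succ⇓

constant⇓⁻¹ : ∀ {n} {xs : Vec ℕ n} c {x} → constant c [ xs ]⇓ x → c ≡ x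
constant⇓⁻¹ zero    zer⇓                   = refl
constant⇓⁻¹ (suc c) (comp⇓ (c⇓ ∷ []) succ⇓) = cong suc (constant⇓⁻¹ c c⇓)

n<2^n : ∀ n → n < 2 ^ n
n<2^n zero    = s≤s z≤n
n<2^n (suc n) = +-mono-≤ (m^n>0 2 n) (subst (suc n ≤_) (sym (+-identityʳ (2 ^ n))) (n<2^n n))

-- Stability notions, provability and codes.

module _ (ξ : Configuration) where
  open Configuration ξ

  E-stable⇒0-stable : EStable ξ → ZeroStable ξ
  E-stable⇒0-stable stable θ J re sharp Υ π δ proves short
    with stable θ J re sharp Υ π (fromΠ (base δ)) proves short
  ... | b , _ , true-scope = subst True (scope-bounded (numeral b) Υ (Δ₀-bounded δ)) true-scope

  A-stable⇒0-stable : AStable ξ → ZeroStable ξ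
  A-stable⇒0-stable stable θ ∞ re sharp Υ π δ proves short =
    -- At `∞` the conclusion `Good½∞` is already plain truth.
    stable θ ∞ re sharp Υ π (fromΣ (base δ)) proves short
  A-stable⇒0-stable stable θ (fin J) re sharp Υ π δ proves short
    with stable θ (fin J) re sharp Υ π (fromΣ (base δ)) proves short
  ... | b , _ , true-scope = subst True (scope-bounded (numeral b) Υ (Δ₀-bounded δ)) true-scope

  singleton-REClass : ∀ {Φ} → Πᶠ 1 Φ → REClass ξ ｛ Φ ｝
  singleton-REClass {Φ} Φ-Π₁ = (λ { refl → Φ-Π₁ }) , constant ⌜ Φ ⌝ , λ x → mk⇔
    (λ { (_ , refl , refl) → 0 , constant⇓ ⌜ Φ ⌝ })
    (λ (_ , ⇓x) → Φ , refl , constant⇓⁻¹ ⌜ Φ ⌝ ⇓x)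

  explosion : ∀ {α Φ} → α ⊢ Φ → α ⊢ ¬' Φ → ∀ Ψ → α ⊢ Ψ
  explosion {Φ = Φ} ⊢Φ ⊢¬Φ Ψ =
    indirectImplication ⊢Φ ⊢¬Φ (tautology (ex-falso-tautology Φ Ψ))

  isProofOf⇒proves : ∀ {α Φ p} → IsProofOf ξ α ⌜ Φ ⌝ p → ∃[ π ] ⌜ π ⌝ᵖ ≡ p × Proves π α Φ
  isProofOf⇒proves (_ , π , ⌜⌝≡ , p≡ , proves) with ⌜⌝-injective ⌜⌝≡
  ... | refl = π , p≡ , proves

  -- `IsSubstPrf` speaks of some formula with code `⌜ Γ ⌝`. Injectivity of codes forces it to be
  -- `Γ`, and `Γ` applied to its own code is `diagonalise ξ Γ`.
  isSubstPrf⇔ : ∀ {β t p} (Γ : Formula L 1) →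
    IsSubstPrf ξ β ⌜ Γ ⌝ t p ⇔ IsProofOf ξ (β ∪ ｛ diagonalise ξ Γ ｝) t p
  isSubstPrf⇔ {β} {t} {p} Γ = mk⇔ unique (λ prf → 1 , Γ , refl , prf)
    where
      unique : IsSubstPrf ξ β ⌜ Γ ⌝ t p → IsProofOf ξ (β ∪ ｛ diagonalise ξ Γ ｝) t p
      unique (_ , _ , ⌜⌝≡ , prf) with ⌜⌝-injective ⌜⌝≡
      ... | refl = prf

  -- The fixed point.

  module _ {k : ℕ} {β : Pred (Sentence L) 0ℓ} (S : SelfConsFormula ξ k β) where
    open SelfConsFormula S

    private
      Γ : Formula L 1
      Γ = diagonal ξ Neg SubstPrf

    -- The self-reference closes here: at `g` equal to `⌜ Γ ⌝`, the sentence that `SubstPrf` adjoins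
    -- to `β` is `SelfCons` itself.
    selfCons-states : StatesConsistency ξ k (β ∪ ｛ SelfCons ｝) SelfCons
    selfCons-states = record
      -- Unification reads the three formulas of the matrix off `SelfCons`.
      { shape = refl
      ; negation-def = λ x y p q → Neg-def x y ⇔-∘ instance⇔ Neg _ x y p q
      ; proof₁-def = λ x y p q →
          isSubstPrf⇔ Γ ⇔-∘ (SubstPrf-def ⌜ Γ ⌝ x p ⇔-∘ instance⇔ SubstPrf _ x y p q)
      ; proof₂-def = λ x y p q →
          isSubstPrf⇔ Γ ⇔-∘ (SubstPrf-def ⌜ Γ ⌝ y q ⇔-∘ instance⇔ SubstPrf _ x y p q)
      }
      where
        -- The diagonal substitution carried under four quantifiers: it fixes `q`, `p`, `y`, `x` and
        -- sends `g` to the numeral.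
        σ : Fin 5 → Term L 4
        σ = lift (lift (lift (lift (lookup (numeral ⌜ Γ ⌝ ∷ [])))))

        numeral≗ : ∀ i → evalᵗ [] (lookup (numeral ⌜ Γ ⌝ ∷ []) i) ≡ lookup (⌜ Γ ⌝ ∷ []) i
        numeral≗ zero = numeral-value ⌜ Γ ⌝

        env : ∀ x y p q i →
          evalᵗ (q ∷ p ∷ y ∷ x ∷ []) (σ i) ≡ lookup (q ∷ p ∷ y ∷ x ∷ ⌜ Γ ⌝ ∷ []) i
        env x y p q = evalᵗ-lift (evalᵗ-lift (evalᵗ-lift (evalᵗ-lift numeral≗ x) y) p) q

        instance⇔ : ∀ {m} (Φ : Formula L m) ts x y p q →
          ⟦ sub σ (Φ ⟨ ts ⟩) ⟧ (q ∷ p ∷ y ∷ x ∷ [])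
            ⇔ ⟦ Φ ⟧ (evalᵗˢ (q ∷ p ∷ y ∷ x ∷ ⌜ Γ ⌝ ∷ []) ts)
        instance⇔ Φ ts x y p q = ⟦⟧-instance Φ ts ⇔-∘ ⟦⟧-sub (env x y p q) (Φ ⟨ ts ⟩)

  -- Goodness as a bounded absence of contradictions.

  module _ (k : ℕ) (α : Pred (Sentence L) 0ℓ) where

    NoContradictionBelow : ℕ → Set
    NoContradictionBelow b = ∀ x → x < b → ∀ y → y < b → ∀ p → p < b → ∀ q → q < b →
      ¬ (IsNegPair ξ k x y × IsProofOf ξ α x p × IsProofOf ξ α y q)

    noContradictionBelow-antitone : ∀ {b c} → b ≤ c →
      NoContradictionBelow c → NoContradictionBelow b
    noContradictionBelow-antitone b≤c none x x< y y< p p< q q< =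
      none x (<-≤-trans x< b≤c) y (<-≤-trans y< b≤c) p (<-≤-trans p< b≤c) q (<-≤-trans q< b≤c)

    -- `scope-∀'` strips the four quantifiers one by one. The matrix begins with `¬'`, so `scope`
    -- leaves it unchanged.
    good⇔noContradictionBelow : ∀ {Υ} → StatesConsistency ξ k α Υ →
      ∀ J → Good ξ J Υ ⇔ NoContradictionBelow (2 ^ J)
    good⇔noContradictionBelow
      record { negation = neg ; negation-def = neg-def
             ; proof₁ = prf₁ ; proof₁-def = prf₁-def
             ; proof₂ = prf₂ ; proof₂-def = prf₂-def
             ; shape = refl } J = mk⇔
      (λ good x x< y y< p p< q q< (is-neg , is-prf₁ , is-prf₂) →
        to (scope-∀' E M)
          (to (scope-∀' E (∀' M))
            (to (scope-∀' E (∀' (∀' M)))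
              (to (scope-∀' E (∀' (∀' (∀' M)))) good x (below x<)) y (below y<)) p (below p<))
          q (below q<)
          ( from (neg-def x y p q) is-neg
          , from (prf₁-def x y p q) is-prf₁
          , from (prf₂-def x y p q) is-prf₂))
      (λ none →
        from (scope-∀' E (∀' (∀' (∀' M)))) λ x x< →
        from (scope-∀' E (∀' (∀' M))) λ y y< →
        from (scope-∀' E (∀' M)) λ p p< →
        from (scope-∀' E M) λ q q< (is-neg , is-prf₁ , is-prf₂) →
          none x (above x<) y (above y<) p (above p<) q (above q<)
            ( to (neg-def x y p q) is-neg
            , to (prf₁-def x y p q) is-prf₁
            , to (prf₂-def x y p q) is-prf₂))
      where
        E = numeral (2 ^ J)
        M = ¬' (neg ∧' prf₁ ∧' prf₂)
        below : ∀ {v} → v < 2 ^ J → v < evalᵗ [] E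
        below {v} = subst (v <_) (sym (numeral-value (2 ^ J)))
        above : ∀ {v} → v < evalᵗ [] E → v < 2 ^ J
        above {v} = subst (v <_) (numeral-value (2 ^ J))

  -- Consistency from 0-stability.

  module _ (S : SelfConsFormula ξ 0 B) (stable : ZeroStable ξ) where
    open SelfConsFormula S

    private
      α : Pred (Sentence L) 0ℓ
      α = B ∪ ｛ SelfCons ｝

      None : ℕ → Set
      None J = NoContradictionBelow 0 α (2 ^ J)

      good⇔ : ∀ J → Good ξ J SelfCons ⇔ None J
      good⇔ = good⇔noContradictionBelow 0 α (selfCons-states S)

      -- An arbitrary `Δ₀` sentence, at which explosion will turn any contradiction into one of
      -- level 0.
      Z : Sentence L
      Z = Add ⟨ numeral 0 ∷ numeral 0 ∷ numeral 0 ∷ [] ⟩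

      Z-Δ₀ : Δ₀ Z
      Z-Δ₀ = Δ₀-instance (numeral 0 ∷ numeral 0 ∷ numeral 0 ∷ []) Add-Δ₀

    -- Below 2^0 the codes of a sentence and of its negation would both be 0.
    none-zero : None 0
    none-zero x x< y y< _ _ _ _ ((Φ , base δ , ⌜Φ⌝≡x , ⌜negΦ⌝≡y) , _)
      with ⌜⌝-injective (trans ⌜Φ⌝≡x (trans (n<1⇒n≡0 x<) (trans (sym (n<1⇒n≡0 y<))
             (trans (sym ⌜negΦ⌝≡y) (cong ⌜_⌝ (prenexNeg-bounded Φ (Δ₀-bounded δ)))))))
    ... | ()

    -- Bounds are nested: goodness at any `J'` above `J` would already give `None (suc J)`.
    sharp : ∀ J → None J → ¬ None (suc J) → Sharp ξ ｛ SelfCons ｝ (fin J)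
    sharp J none ¬none = (λ { refl → from (good⇔ J) none }) , maximal
      where
        maximal : ∀ J' → AllGood ξ ｛ SelfCons ｝ J' → J' ≤ J
        maximal J' good with J' ≤? J
        ... | yes J'≤J = J'≤J
        ... | no  J'≰J with () ← ¬none (noContradictionBelow-antitone 0 α
                (^-monoʳ-≤ 2 (≰⇒> J'≰J)) (to (good⇔ J') (good refl)))

    -- Assuming `None (suc J)` fails fixes the sharpness of the axiom at exactly `J`. Stability then
    -- covers all proofs with codes below `2 ^ suc J`, which yields `None (suc J)` after all.
    none-suc : ∀ J → None J → ¬ ¬ None (suc J)
    none-suc J none ¬none = ¬none contradiction-free
      where
        provable-true : ∀ {Υ p} → p < 2 ^ suc J → Δ₀ Υ → IsProofOf ξ α ⌜ Υ ⌝ p → True Υ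
        provable-true p< δ prf with isProofOf⇒proves prf
        ... | π , refl , proves =
          stable ｛ SelfCons ｝ (fin J) (singleton-REClass isΠ₁) (sharp J none ¬none) _ π δ
            -- Stability lists `θ` before `B`, whereas `α` lists `B` first. A code below `2 ^ suc J`
            -- has logarithm at most `J + 1`, as stability demands.
            (proves-ext (swap , swap) proves) (<⇒≤ p<)

        contradiction-free : None (suc J)
        contradiction-free _ _ _ _ p p< q q< ((Φ , base δ , refl , refl) , prf₁ , prf₂) =
          -- Truth of `¬' Φ` is a function into `⊥`, applied here to the truth of `Φ`.
          provable-true q< (Δ₀-¬ δ)
            (subst (λ Ψ → IsProofOf ξ α ⌜ Ψ ⌝ q) (prenexNeg-bounded Φ (Δ₀-bounded δ)) prf₂)
            (provable-true p< δ prf₁)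

    -- Induction on `J` replaces the search for the sharp value, so no excluded middle is used.
    ¬¬none : ∀ J → ¬ ¬ None J
    ¬¬none zero    ¬none = ¬none none-zero
    ¬¬none (suc J) ¬none = ¬¬none J λ none → none-suc J none ¬none

    selfCons-consistent : Consistent ξ α
    selfCons-consistent Ψ (⊢Ψ , ⊢¬Ψ)
      with explosion {Φ = Ψ} ⊢Ψ ⊢¬Ψ Z | explosion {Φ = Ψ} ⊢Ψ ⊢¬Ψ (¬' Z)
    ... | π₁ , proves₁ | π₂ , proves₂ = ¬¬none N λ none →
      none x (<2^N (≤-trans (m≤m+n x y) (m≤m+n _ _)))
           y (<2^N (≤-trans (m≤n+m y x) (m≤m+n _ _)))
           p (<2^N (≤-trans (m≤m+n p q) (m≤n+m _ (x + y))))
           q (<2^N (≤-trans (m≤n+m q p) (m≤n+m _ (x + y))))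
           ( (Z , base Z-Δ₀ , refl , cong ⌜_⌝ (prenexNeg-bounded Z (Δ₀-bounded Z-Δ₀)))
           , (Z , π₁ , refl , refl , proves₁)
           , (¬' Z , π₂ , refl , refl , proves₂))
      where
        x = ⌜ Z ⌝
        y = ⌜ ¬' Z ⌝
        p = ⌜ π₁ ⌝ᵖ
        q = ⌜ π₂ ⌝ᵖ
        -- The sum dominates all four codes, and `N < 2 ^ N`, so the contradiction at `Z` lies
        -- within the bound of `None N`.
        N = (x + y) + (p + q)
        <2^N : ∀ {v} → v ≤ N → v < 2 ^ N
        <2^N v≤N = <-≤-trans (s≤s v≤N) (n<2^n N)

theorem5p11 : (ξ : Configuration) (S : SelfConsFormula ξ 0 (Configuration.B ξ)) →
    ZeroStable ξ ⊎ EStable ξ ⊎ AStable ξ →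
    Σ[ J ∈ SelfJustifying ξ 0 (Configuration.B ξ ∪ ｛ SelfConsFormula.SelfCons S ｝) ]
    SelfJustifying.Υ J ≡ SelfConsFormula.SelfCons S
theorem5p11 ξ S stable = justification , refl
  where
    justification : SelfJustifying ξ 0 (Configuration.B ξ ∪ ｛ SelfConsFormula.SelfCons S ｝)
    justification = record
      { Υ = SelfConsFormula.SelfCons S
      ; provable = Configuration.axiom ξ (inj₂ refl)
      ; states = selfCons-states ξ S
      ; consistent = selfCons-consistent ξ S
          ([ (λ zero-stable → zero-stable) , [ E-stable⇒0-stable ξ , A-stable⇒0-stable ξ ] ] stable)
      }
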